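{- Let $t=1$ and let $m\ge 2$, $n\ge 1$, $\lambda\ge 1$ be integers with $m\le\lambda\le\frac{n(n-1)}{2}$. \begin{enumerate} \item[(a)] If $\mu(\lambda,m;1)\ge n-1$ and $2\lambda\ge 2n$, then there exists a $(1+1)$-color connected colored edge graph $G(V,E,C,f)$ with $|V|=n$, $|E|=\lambda$, $|C|=m$. \item[(b)] Suppose $m>2$ and $2\lambda\ge 2n$, and suppose that: if $n=(m-1)k$ for some integer $k>0$ then $\lambda\ge mk-1$; if $n=(m-1)k+1$ for some integer $k>0$ then $\lambda\ge mk$; and for every integer $j$ with $2\le j\le m-2$, if $n=(m-1)k+j$ for some integer $k>0$ then $\lambda\ge mk+j$. Then there exists a $(1+1)$-color connected colored edge graph $G(V,E,C,f)$ with $|V|=n$, $|E|=\lambda$, $|C|=m$. \end{enumerate}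
   Context: All graphs are finite, undirected and simple (no loops, no multiple edges). A colored edge graph is a tuple $G(V,E,C,f)$ where $(V,E)$ is a graph with node set $V$ and edge set $E$, $C$ is a finite set of colors, and $f:E\to C$ is a surjective map. Two distinct nodes $A,B\in V$ are $(1+1)$-color connected if for every color $c\in C$ there is a path from $A$ to $B$ in $G$ none of whose edges has color $c$. The colored edge graph $G$ is $(1+1)$-color connected if every two distinct nodes of $G$ are $(1+1)$-color connected. A $(\lambda,m)$-partition is a pair $(X,\mathcal{F})$ where $X$ is a finite set with $|X|=\lambda$ and $\mathcal{F}$ is a set of mutually disjoint subsets of $X$ with $|\mathcal{F}|=m$ and $X=\bigcup_{P\in\mathcal{F}}P$. For $1\le t\le m$ put $\mu(X,\mathcal{F};t)=\min\{|X\setminus(B_1\cup\cdots\cup B_t)| : B_1,\ldots,B_t \text{ distinct elements of } \mathcal{F}\}$, and $\mu(\lambda,m;t)=\max\{\mu(X,\mathcal{F};t): (X,\mathcal{F})\text{ is a }(\lambda,m)\text{ -partition}\}$. -}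

module Defs where

open import Data.Fin.Base using (Fin)
open import Data.Fin.Subset using (Subset; ⊤; ⋃; ∁; _∩_; ∣_∣; Empty)
open import Data.List.Base using (List; []; _∷_; length)
open import Data.List.Membership.Propositional using (_∈_)
open import Data.List.Relation.Unary.All using (All)
open import Data.List.Relation.Unary.AllPairs using (AllPairs)
open import Data.List.Relation.Unary.Unique.Propositional using (Unique)
open import Data.Nat.Base using (ℕ; _≤_)
open import Data.Product.Base using (Σ-syntax; _×_; _,_)
open import Data.Sum.Base using (_⊎_)
open import Function.Bundles using (_↔_)
open import Function.Definitions using (Surjective)
open import Relation.Binary.PropositionalEquality using (_≡_; _≢_)
open import Relation.Nullary using (¬_)

-- E is presented as a finite type in which each edge lists its two ends in
-- some order; Joins forgets that order.  By `loopless` and `simple`, E is then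
-- the same thing as a set of two-element subsets of V.
record ColoredEdgeGraph : Set₁ where
  field
    V E C : Set
    ∣V∣ ∣E∣ ∣C∣ : ℕ
    V↔Fin : V ↔ Fin ∣V∣
    E↔Fin : E ↔ Fin ∣E∣
    C↔Fin : C ↔ Fin ∣C∣
    ends : E → V × V

  Joins : E → V → V → Set
  Joins e A B = (ends e ≡ (A , B)) ⊎ (ends e ≡ (B , A))

  field
    loopless : ∀ e A → ¬ Joins e A A
    simple : ∀ e e′ A B → Joins e A B → Joins e′ A B → e ≡ e′
    f : E → C
    f-surjective : Surjective _≡_ _≡_ f

module _ (G : ColoredEdgeGraph) where
  open ColoredEdgeGraph G

  data Walk : V → V → Set where
    stop : ∀ {A} → Walk A A
    step : ∀ {A B D} (e : E) → Joins e A B → Walk B D → Walk A D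

  nodes : ∀ {A B} → Walk A B → List V
  nodes {A} stop = A ∷ []
  nodes {A} (step _ _ w) = A ∷ nodes w

  edges : ∀ {A B} → Walk A B → List E
  edges stop = []
  edges (step e _ w) = e ∷ edges w

  IsPath : ∀ {A B} → Walk A B → Set
  IsPath w = Unique (nodes w)

  NodesColorConnected : V → V → Set
  NodesColorConnected A B =
    ∀ (c : C) → Σ[ p ∈ Walk A B ] IsPath p × All (λ e → f e ≢ c) (edges p)

  ColorConnected : Set
  ColorConnected = ∀ (A B : V) → A ≢ B → NodesColorConnected A B

-- A (l , m)-partition; the underlying set X is taken to be Fin l, since only
-- cardinalities of subsets of X matter.  A set of subsets is a duplicate-free
-- list.  As in the definition being formalized, ∅ may be one of the blocks.
record Partition (l m : ℕ) : Set where
  field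
    blocks : List (Subset l)
    distinct : Unique blocks
    disjoint : AllPairs (λ P Q → Empty (P ∩ Q)) blocks
    covers : ⋃ blocks ≡ ⊤
    size : length blocks ≡ m

IsMinimum IsMaximum : (ℕ → Set) → ℕ → Set
IsMinimum S v = S v × (∀ w → S w → v ≤ w)
IsMaximum S v = S v × (∀ w → S w → w ≤ v)

-- μ(X , F ; t) = v
IsPartitionμ : ∀ {l m} → Partition l m → ℕ → ℕ → Set
IsPartitionμ {l} 𝓕 t = IsMinimum λ w →
  Σ[ Bs ∈ List (Subset l) ]
    Unique Bs × All (_∈ Partition.blocks 𝓕) Bs × length Bs ≡ t
    × w ≡ ∣ ∁ (⋃ Bs) ∣

-- μ(l , m ; t) = v.  Such a v is unique, and exists whenever 1 ≤ t ≤ m ≤ l.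
Isμ : (l m t : ℕ) → ℕ → Set
Isμ l m t = IsMaximum λ w → Σ[ 𝓕 ∈ Partition l m ] IsPartitionμ 𝓕 t w

ColorConnectedGraphExists : (n l m : ℕ) → Set₁
ColorConnectedGraphExists n l m =
  Σ[ G ∈ ColoredEdgeGraph ]
    ColorConnected G
    × ColoredEdgeGraph.∣V∣ G ≡ n
    × ColoredEdgeGraph.∣E∣ G ≡ l
    × ColoredEdgeGraph.∣C∣ G ≡ m

{-# OPTIONS --safe #-}
module Submission where

-- Put s = l - (n - 1).  The hypotheses of both parts imply n - 1 ≤ (m - 1) s: in (a)
-- because every block of the optimal partition has at most s elements.  So the
-- n - 1 nodes other than the root can be supplied by s ears with at most m - 1
-- inner nodes each, using at most (n - 1) + s = l edges.  If no colour is repeated on an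
-- ear, deleting a colour cuts each ear at most once and leaves every inner node
-- attached to one of its ends.  All ears run from node 1 to node 0, so that an ear
-- with a single inner node is still simple.  For m ≥ 3 the first ear contains the
-- edge 0-1; for m = 2 the construction starts from K₄, the union of two disjoint
-- Hamiltonian paths.  Further edges, in any colour, do no harm.

open import Defs
open import Data.Empty using (⊥-elim)
open import Data.Fin.Base using (Fin; toℕ; zero; suc)
import Data.Fin.Properties as Fin
open import Data.Fin.Subset using (Subset; ⊤; ⋃; ∁; _∪_; ∣_∣; inside; outside)
open import Data.Fin.Subset.Properties using (∣∁p∣≡n∸∣p∣; ∣⊤∣≡n; ∣⊥∣≡0; ∣p∣≤n; ∪-identityʳ)
open import Data.List.Base using (List; []; _∷_; _++_; length; lookup; map; upTo)
open import Data.List.Membership.Propositional using (_∈_; _∉_)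
open import Data.List.Membership.Propositional.Properties using (∈-lookup; ∈-map⁺; ∈-map⁻; ∈-upTo⁻)
open import Data.List.Properties using (length-map; length-++; length-upTo)
open import Data.List.Relation.Unary.All as All using (All; []; _∷_)
import Data.List.Relation.Unary.All.Properties as All
open import Data.List.Relation.Unary.AllPairs as AllPairs using (AllPairs; []; _∷_)
open import Data.List.Relation.Unary.Any as Any using (here; there)
open import Data.List.Relation.Unary.Any.Properties using (lookup-index)
open import Data.List.Relation.Unary.Unique.Propositional using (Unique)
import Data.List.Relation.Unary.Unique.Propositional.Properties as Unique
open import Data.Nat using (ℕ; zero; suc; _+_; _*_; _∸_; _/_; _%_; _≤_; _<_; _≥_; _>_; z≤n; s≤s; NonZero; _<?_)
open import Data.Nat.DivMod using (_mod_; m≡m%n+[m/n]*n; m%n<n; m/n*n≤m; m<n⇒m%n≡m)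
open import Data.Nat.Properties
open import Data.Nat.Tactic.RingSolver using (solve-∀)
open import Data.Product using (∃; Σ-syntax; ∃-syntax; _×_; _,_; proj₁; proj₂)
open import Data.Product.Properties using (,-injectiveˡ; ,-injectiveʳ; ≡-dec)
open import Data.Vec.Base using ([]; _∷_)
open import Data.Sum using (_⊎_; inj₁; inj₂; [_,_]′)
open import Function.Base using (id; _∘_; _on_)
open import Function.Construct.Identity using (↔-id)
open import Relation.Binary.Construct.Closure.Equivalence as EqC using (EqClosure)
open import Relation.Binary.Construct.Closure.ReflexiveTransitive using (Star; ε; _◅_; _◅◅_)
open import Relation.Binary.Construct.Closure.Symmetric using (fwd; bwd)
open import Relation.Binary.Definitions using (DecidableEquality)
open import Relation.Binary.PropositionalEquality
open import Relation.Nullary using (Dec; yes; no; contradiction)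
open import Relation.Nullary.Decidable using (from-yes; _×-dec_; ¬?)

-- Walks and paths

module _ (G : ColoredEdgeGraph) (_≟V_ : DecidableEquality (ColoredEdgeGraph.V G)) where

  open ColoredEdgeGraph G using (V; E; Joins)
  open import Data.List.Membership.DecPropositional _≟V_ using (_∈?_)

  suffix : ∀ {P : E → Set} {A B X} (w : Walk G A B) → X ∈ nodes G w →
    IsPath G w → All P (edges G w) →
    Σ[ p ∈ Walk G X B ] IsPath G p × All P (edges G p)
  suffix stop         (here refl) u       ps       = stop , u , ps
  suffix (step e j w) (here refl) u       ps       = step e j w , u , ps
  suffix (step e j w) (there x∈)  (_ ∷ u) (_ ∷ ps) = suffix w x∈ u ps

  -- If the node just prepended already lies on the path found so far, the detour is dropped and the
  -- suffix from that node is kept; no edge is added by this, so `P` survives.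
  loop-erase : ∀ {P : E → Set} {A B} → Star (λ X Y → ∃[ e ] P e × Joins e X Y) A B →
    Σ[ p ∈ Walk G A B ] IsPath G p × All P (edges G p)
  loop-erase ε = stop , [] ∷ [] , []
  loop-erase {A = A} ((e , pe , j) ◅ r) with loop-erase r
  ... | w , u , ps with A ∈? nodes G w
  ...   | yes A∈ = suffix w A∈ u ps
  ...   | no  A∉ = step e j w , All.¬Any⇒All¬ _ A∉ ∷ u , pe ∷ ps

-- Lists

-- The map `g` allows two uses: with `id` for duplicate-free lists, with `pair` for edges determined
-- by their ends.
lookup-injective : ∀ {A B : Set} {g : A → B} {xs} → AllPairs (_≢_ on g) xs →
  ∀ i j → g (lookup xs i) ≡ g (lookup xs j) → i ≡ j
lookup-injective (_  ∷ _) zero    zero    _  = refl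
lookup-injective (px ∷ _) zero    (suc j) eq = contradiction eq (All.lookup px (∈-lookup j))
lookup-injective (px ∷ _) (suc i) zero    eq = contradiction (sym eq) (All.lookup px (∈-lookup i))
lookup-injective (_  ∷ u) (suc i) (suc j) eq = cong suc (lookup-injective u i j eq)

Unique-⊆⇒length≤ : ∀ {A : Set} {xs ys : List A} → Unique xs → All (_∈ ys) xs → length xs ≤ length ys
Unique-⊆⇒length≤ {xs = xs} {ys} u sub =
  Fin.injective⇒≤ {f = λ i → Any.index (∈ys i)} λ {i} {j} eq →
    lookup-injective {g = id} u i j
      (trans (lookup-index (∈ys i)) (trans (cong (lookup ys) eq) (sym (lookup-index (∈ys j)))))
  where
  ∈ys : ∀ i → lookup xs i ∈ ys
  ∈ys i = All.lookup sub (∈-lookup i)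

-- The edge set of the complete graph on 0, ... , n - 1, smaller end first.
pairs : ℕ → List (ℕ × ℕ)
pairs zero    = []
pairs (suc n) = map (_, n) (upTo n) ++ pairs n

pairs-ordered : ∀ n → All (λ (a , b) → a < b × b < n) (pairs n)
pairs-ordered zero    = []
pairs-ordered (suc n) = All.++⁺
  (All.map⁺ (All.tabulate λ a∈ → ∈-upTo⁻ a∈ , n<1+n n))
  (All.map (λ (a<b , b<n) → a<b , m<n⇒m<1+n b<n) (pairs-ordered n))

pairs-unique : ∀ n → Unique (pairs n)
pairs-unique zero    = []
pairs-unique (suc n) = Unique.++⁺ (Unique.map⁺ ,-injectiveˡ (Unique.upTo⁺ n)) (pairs-unique n)
  λ (v∈ , v∈′) → disjoint (∈-map⁻ _ v∈) v∈′
  where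
  disjoint : ∀ {v} → (∃ λ a → a ∈ upTo n × v ≡ (a , n)) → v ∉ pairs n
  disjoint (_ , _ , refl) v∈ = <-irrefl refl (proj₂ (All.lookup (pairs-ordered n) v∈))

length-pairs : ∀ n → 2 * length (pairs n) ≡ n * (n ∸ 1)
length-pairs zero    = refl
length-pairs (suc n) = begin
  2 * length (map (_, n) (upTo n) ++ pairs n)         ≡⟨ cong (2 *_) (length-++ (map (_, n) (upTo n))) ⟩
  2 * (length (map (_, n) (upTo n)) + length (pairs n))
    ≡⟨ cong (λ h → 2 * (h + length (pairs n))) (trans (length-map _ (upTo n)) (length-upTo n)) ⟩
  2 * (n + length (pairs n))                          ≡⟨ *-distribˡ-+ 2 n _ ⟩
  2 * n + 2 * length (pairs n)                        ≡⟨ cong (2 * n +_) (length-pairs n) ⟩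
  2 * n + n * (n ∸ 1)                                 ≡⟨ arith n ⟩
  suc n * n                                           ∎
  where
  open ≡-Reasoning
  expand : ∀ k → 2 * suc k + suc k * k ≡ suc (suc k) * suc k
  expand = solve-∀
  arith : ∀ n → 2 * n + n * (n ∸ 1) ≡ suc n * n
  arith zero    = refl
  arith (suc k) = expand k

-- Coloured edge lists

-- Two ends and a colour, all plain numbers, so that old edges need no re-typing when a node is
-- added.
Edge : Set
Edge = ℕ × ℕ × ℕ

pair : Edge → ℕ × ℕ
pair (a , b , _) = a , b

colour : Edge → ℕ
colour (_ , _ , c) = c

Link : List Edge → ℕ → ℕ → ℕ → Set
Link es c a b = ∃[ d ] d ≢ c × (a , b , d) ∈ es

Connected : List Edge → ℕ → ℕ → ℕ → Set
Connected es c = EqClosure (Link es c)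

weaken : ∀ {e es c u v} → Connected es c u v → Connected (e ∷ es) c u v
weaken = EqC.map λ (d , d≢c , e∈) → d , d≢c , there e∈

along : ∀ {es c a b} d → d ≢ c → (a , b , d) ∈ es → Connected es c a b
along d d≢c e∈ = fwd (d , d≢c , e∈) ◅ ε

against : ∀ {es c a b} d → d ≢ c → (a , b , d) ∈ es → Connected es c b a
against d d≢c e∈ = bwd (d , d≢c , e∈) ◅ ε

AllColours : ℕ → List ℕ → Set
AllColours m cs = ∀ c → c < m → c ∈ cs

-- k is the colour to be given to the next edge; as long as colours are missing,
-- the edges carry the colours 0 , … , k - 1, once each.
Palette : ℕ → ℕ → List ℕ → Set
Palette m k cs = (length cs ≡ k × AllColours k cs) ⊎ AllColours m cs

next-colour : ∀ {m k cs} → Palette m k cs → Palette m (suc k) (k ∷ cs)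
next-colour (inj₁ (len , cols)) = inj₁ (cong suc len , λ c c<1+k →
  [ there ∘ cols c , here ]′ (m<1+n⇒m<n∨m≡n c<1+k))
next-colour (inj₂ all) = inj₂ λ c c<m → there (all c c<m)

record Coloured (m n k : ℕ) (es : List Edge) : Set where
  field
    bounded : All (λ (a , b , c) → a < b × b < n × c < m) es
    simple  : AllPairs (_≢_ on pair) es
    palette : Palette m k (map colour es)

-- In the first state of the palette the colours below k all occur, so k ≥ m suffices. That bound is
-- only needed when there are exactly k edges, which lets a lower bound on the number of edges serve
-- as well.
exhausted : ∀ {m n k es} → Coloured m n k es → (length es ≡ k → m ≤ k) → AllColours m (map colour es)
exhausted {es = es} col m≤k with Coloured.palette col
... | inj₁ (len , cols) = λ c c<m → cols c (<-≤-trans c<m (m≤k (trans (sym (length-map colour es)) len)))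
... | inj₂ all          = all

record Network (m n k : ℕ) (es : List Edge) : Set where
  field
    coloured  : Coloured m n k es
    connected : ∀ c v → v < n → Connected es c v 0
  open Coloured coloured public

-- An ear that has reached the node tip with edges of colours below k.
record OpenEar (m n tip k : ℕ) (es : List Edge) : Set where
  field
    coloured     : Coloured m n k es
    0<tip        : 0 < tip
    tip<n        : tip < n
    root-or-tip  : ∀ c v → v < n → Connected es c v 0 ⊎ Connected es c v tip
    unused       : ∀ c v → k ≤ c → v < n → Connected es c v 0
  open Coloured coloured public

-- Adding nodes and edges along ears

new-node-fresh : ∀ {m n k es} a → Coloured m n k es → All (λ e → (a , n) ≢ pair e) es
new-node-fresh a col = All.map (λ (_ , b<n , _) eq → <⇒≢ b<n (sym (,-injectiveʳ eq))) (Coloured.bounded col)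

insert : ∀ {m n n′ k es a b} → n ≤ n′ → Coloured m n k es → a < b → b < n′ → k < m →
  All (λ e → (a , b) ≢ pair e) es → Coloured m n′ (suc k) ((a , b , k) ∷ es)
insert n≤n′ col a<b b<n′ k<m fresh = record
  { bounded = (a<b , b<n′ , k<m) ∷ All.map (λ (p , b<n , q) → p , <-≤-trans b<n n≤n′ , q) bounded
  ; simple  = fresh ∷ simple
  ; palette = next-colour palette
  }
  where open Coloured col

module _ {m n tip k es} (ear : OpenEar m n tip k es) (k<m : k < m) where
  open OpenEar ear

  extend : OpenEar m (suc n) n (suc k) ((tip , n , k) ∷ es)
  extend = record
    { coloured    = insert (n≤1+n n) coloured tip<n (n<1+n n) k<m (new-node-fresh tip coloured)
    ; 0<tip       = ≤-<-trans z≤n tip<n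
    ; tip<n       = n<1+n n
    ; root-or-tip = λ c v v<1+n → [ old c v , (λ { refl → inj₂ ε }) ]′ (m<1+n⇒m<n∨m≡n v<1+n)
    ; unused      = λ c v k<c v<1+n → [ (λ v<n → weaken (unused c v (<⇒≤ k<c) v<n))
                                      , (λ { refl → new c k<c }) ]′ (m<1+n⇒m<n∨m≡n v<1+n)
    }
    where
    old : ∀ c v → v < n → Connected _ c v 0 ⊎ Connected _ c v n
    old c v v<n with k ≟ c | root-or-tip c v v<n
    ... | yes refl | _        = inj₁ (weaken (unused k v ≤-refl v<n))
    ... | no  _    | inj₁ p   = inj₁ (weaken p)
    ... | no  k≢c  | inj₂ p   = inj₂ (weaken p ◅◅ along k k≢c (here refl))
    new : ∀ c → k < c → Connected _ c n 0
    new c k<c = against k (<⇒≢ k<c) (here refl) ◅◅ weaken (unused c tip (<⇒≤ k<c) tip<n)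

-- The closing edge ends at a new node, so it repeats no old pair, and `0<tip` separates it from the
-- other new edge. If its colour k + 1 is deleted, the ear is otherwise intact; if not, nodes
-- attached to the tip reach 0 through it.
close : ∀ {m n tip k es} → OpenEar m n tip k es → suc k < m →
  Network m (suc n) (2 + k) ((0 , n , suc k) ∷ (tip , n , k) ∷ es)
close {m} {n} {tip} {k} {es} ear 1+k<m = record
  { coloured = insert ≤-refl (OpenEar.coloured ear′) (≤-<-trans z≤n tip<n) (n<1+n n) 1+k<m
      ((λ eq → <⇒≢ 0<tip (,-injectiveˡ eq)) ∷ new-node-fresh 0 coloured)
  ; connected = conn
  }
  where
  open OpenEar ear
  ear′ = extend ear (<⇒≤ 1+k<m)
  conn : ∀ c v → v < suc n → Connected _ c v 0
  conn c v v<1+n with suc k ≟ c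
  ... | yes refl = weaken (OpenEar.unused ear′ c v ≤-refl v<1+n)
  ... | no  1+k≢c with OpenEar.root-or-tip ear′ c v v<1+n
  ...   | inj₁ p = weaken p
  ...   | inj₂ p = weaken p ◅◅ against (suc k) 1+k≢c (here refl)

-- A new ear starts at node 1 without edges. The colour index may restart at 0 because every colour
-- has already occurred.
reopen : ∀ {m n k es} → 1 < n → Network m n k es → AllColours m (map colour es) → OpenEar m n 1 0 es
reopen 1<n net all = record
  { coloured    = record { bounded = bounded ; simple = simple ; palette = inj₂ all }
  ; 0<tip       = ≤-refl
  ; tip<n       = 1<n
  ; root-or-tip = λ c v v<n → inj₁ (connected c v v<n)
  ; unused      = λ c v _ v<n → connected c v v<n
  }
  where open Network net

-- d nodes are missing and s ears may still be closed, each with at most 1 + M new nodes.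
grow : ∀ {M x tip k es n} d s → OpenEar (2 + M) x tip k es → k ≤ M → (d ≡ 0 → k ≡ 0) →
  d + k ≤ suc M * s → x + d ≡ n →
  ∃[ k′ ] ∃[ es′ ] Network (2 + M) n k′ es′ × length es′ ≤ length es + d + s
grow {x = x} zero s ear _ k≡0 _ refl with k≡0 refl
... | refl rewrite +-identityʳ x = _ , _ , record
  { coloured = OpenEar.coloured ear ; connected = λ c v → OpenEar.unused ear c v z≤n }
  , ≤-trans (m≤m+n _ 0) (m≤m+n _ s)
grow {M} (suc d) zero ear _ _ room _ rewrite *-zeroʳ M = ⊥-elim (1+n≰n (≤-trans (s≤s z≤n) room))
grow {M} {x} {k = k} {es} (suc d) (suc s) ear k≤M _ room eq with d ≟ 0 | k <? M
-- The last missing node closes the ear, full or not; the other ears stay unspent.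
... | yes refl | _ rewrite sym (trans (+-comm 1 x) eq) =
  _ , _ , close ear (s≤s (s≤s k≤M)) , ≤-trans (m≤m+n _ s) (≤-reflexive (arith (length es) s))
  where
  arith : ∀ a s → 2 + a + s ≡ a + 1 + suc s
  arith = solve-∀
... | no d≢0 | yes k<M
  with grow d (suc s) (extend ear (s≤s (m≤n⇒m≤1+n k≤M))) k<M (⊥-elim ∘ d≢0)
         (≤-trans (≤-reflexive (+-suc d k)) room) (trans (sym (+-suc x d)) eq)
...   | _ , _ , net , len = _ , _ , net ,
        ≤-trans len (≤-reflexive (cong (_+ suc s) (sym (+-suc (length es) d))))
-- At k = M only the colours M and M + 1 are left, so the ear must close. The colour index is then
-- m, so all colours have occurred and the next ear may start again from colour 0.
grow {M} {x} {k = k} {es} (suc d) (suc s) ear k≤M _ room eq | no d≢0 | no k≮M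
  with ≤-antisym k≤M (≮⇒≥ k≮M)
... | refl
  with grow d s (reopen (s≤s (≤-<-trans z≤n (OpenEar.tip<n ear))) closed
                  (exhausted (Network.coloured closed) λ _ → ≤-refl))
         z≤n (λ _ → refl) room′ (trans (sym (+-suc x d)) eq)
  where
  closed = close ear (s≤s (s≤s k≤M))
  room′ : d + 0 ≤ suc k * s
  room′ = +-cancelʳ-≤ (suc k) _ _ (begin
    d + 0 + suc k     ≡⟨ cong (_+ suc k) (+-identityʳ d) ⟩
    d + suc k         ≡⟨ +-suc d k ⟩
    suc d + k         ≤⟨ room ⟩
    suc k * suc s     ≡⟨ *-suc (suc k) s ⟩
    suc k + suc k * s ≡⟨ +-comm (suc k) _ ⟩
    suc k * s + suc k ∎)
    where open ≤-Reasoning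
... | _ , _ , net , len = _ , _ , net , ≤-trans len (≤-reflexive (arith (length es) d s))
  where
  arith : ∀ a d s → 2 + a + d + s ≡ a + suc d + suc s
  arith = solve-∀

-- The supply of unused pairs lasts up to the complete graph.
pad : ∀ {m n k es} d → 0 < m → Network m n k es → length es + d ≤ length (pairs n) →
  ∃[ k′ ] ∃[ es′ ] Network m n k′ es′ × length es′ ≡ length es + d
pad zero _ net _ = _ , _ , net , sym (+-identityʳ _)
pad {m} {n} {k} {es} (suc d) 0<m net room = proceed (All.all? (_∈? map pair es) (pairs n))
  where
  open Network net
  open import Data.List.Membership.DecPropositional (≡-dec _≟_ _≟_) using (_∈?_)
  continue : ∀ {a b c k′} → a < b × b < n × c < m → (a , b) ∉ map pair es →
    Palette m k′ (c ∷ map colour es) → ∃[ k′ ] ∃[ es′ ] Network m n k′ es′ × length es′ ≡ length es + suc d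
  continue bound new pal
    with pad d 0<m
      record { coloured = record
                 { bounded = bound ∷ bounded
                 ; simple  = All.tabulate (λ e∈ eq → new (subst (_∈ map pair es) (sym eq) (∈-map⁺ pair e∈))) ∷ simple
                 ; palette = pal }
             ; connected = λ c v v<n → weaken (connected c v v<n) }
      (≤-trans (≤-reflexive (sym (+-suc (length es) d))) room)
  ... | _ , _ , net′ , len = _ , _ , net′ , trans len (sym (+-suc (length es) d))
  proceed : Dec (All (_∈ map pair es) (pairs n)) → ∃[ k′ ] ∃[ es′ ] Network m n k′ es′ × length es′ ≡ length es + suc d
  proceed (yes full) = contradiction
    (≤-trans room
      (≤-trans (Unique-⊆⇒length≤ (pairs-unique n) full) (≤-reflexive (length-map pair es))))
    (m+1+n≰m (length es) {d})
  proceed (no ¬full) with All.¬All⇒Any¬ (_∈? map pair es) (pairs n) ¬full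
  ... | p∉ with All.lookupAny (pairs-ordered n) p∉
  ...   | (a<b , b<n) , new with k <? m
  ...     | yes k<m = continue (a<b , b<n , k<m) new (next-colour palette)
  -- All m colours have occurred, so colour 0 can be repeated, and the index `k′` no longer matters.
  ...     | no  k≮m = continue {k′ = 0} (a<b , b<n , 0<m) new
              (inj₂ λ c c<m → there (exhausted coloured (λ _ → ≮⇒≥ k≮m) c c<m))

-- Edge lists as graphs

-- Reduction mod n sends numbers to `Fin n` without carrying a bound; on numbers below n it inverts
-- `toℕ`.
mod-toℕ : ∀ {n} .{{_ : NonZero n}} (i : Fin n) → toℕ i mod n ≡ i
mod-toℕ {n} i = Fin.toℕ-injective (trans (Fin.toℕ-fromℕ< _) (m<n⇒m%n≡m (Fin.toℕ<n i)))

toℕ-mod : ∀ {n} .{{_ : NonZero n}} {a} → a < n → toℕ (a mod n) ≡ a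
toℕ-mod a<n = trans (Fin.toℕ-fromℕ< _) (m<n⇒m%n≡m a<n)

mod-injective : ∀ {n} .{{_ : NonZero n}} {a b} → a < n → b < n → a mod n ≡ b mod n → a ≡ b
mod-injective a<n b<n eq = trans (sym (toℕ-mod a<n)) (trans (cong toℕ eq) (toℕ-mod b<n))

module _ {m n k es} .{{_ : NonZero m}} .{{_ : NonZero n}} (net : Network m n k es) (all : AllColours m (map colour es)) where
  private
    open module N = Network net using (bounded; connected)

    bound : ∀ i → let (a , b , c) = lookup es i in a < b × b < n × c < m
    bound i = All.lookup bounded (∈-lookup i)

    endsOf : Edge → Fin n × Fin n
    endsOf (a , b , _) = a mod n , b mod n

    ends-injective : ∀ i j → endsOf (lookup es i) ≡ endsOf (lookup es j) → i ≡ j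
    ends-injective i j eq = let (a<b , b<n , _) = bound i ; (a′<b′ , b′<n , _) = bound j in
      lookup-injective {g = pair} N.simple i j (cong₂ _,_
        (mod-injective (<-trans a<b b<n) (<-trans a′<b′ b′<n) (,-injectiveˡ eq))
        (mod-injective b<n b′<n (,-injectiveʳ eq)))

    -- Every edge points upwards, which excludes loops and two edges joining the same nodes in
    -- opposite order.
    ends-ordered : ∀ i {A B} → endsOf (lookup es i) ≡ (A , B) → toℕ A < toℕ B
    ends-ordered i refl = let (a<b , b<n , _) = bound i in
      subst₂ _<_ (sym (toℕ-mod (<-trans a<b b<n))) (sym (toℕ-mod b<n)) a<b

  graph : ColoredEdgeGraph
  graph = record
    { V = Fin n ; E = Fin (length es) ; C = Fin m
    ; V↔Fin = ↔-id _ ; E↔Fin = ↔-id _ ; C↔Fin = ↔-id _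
    ; ends = λ i → endsOf (lookup es i)
    ; loopless = λ i A → [ (λ eq → <-irrefl refl (ends-ordered i eq)) , (λ eq → <-irrefl refl (ends-ordered i eq)) ]′
    ; simple = λ where
        i j A B (inj₁ p) (inj₁ q) → ends-injective i j (trans p (sym q))
        i j A B (inj₁ p) (inj₂ q) → contradiction (ends-ordered i p) (<-asym (ends-ordered j q))
        i j A B (inj₂ p) (inj₁ q) → contradiction (ends-ordered i p) (<-asym (ends-ordered j q))
        i j A B (inj₂ p) (inj₂ q) → ends-injective i j (trans p (sym q))
    ; f = λ i → colour (lookup es i) mod m
    ; f-surjective = λ c → let (e , e∈ , eq) = ∈-map⁻ colour (all (toℕ c) (Fin.toℕ<n c)) in
        Any.index e∈ , λ where
          refl → trans (cong (λ e → colour e mod m) (sym (lookup-index e∈)))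
                   (trans (cong (_mod m) (sym eq)) (mod-toℕ c))
    }

  open ColoredEdgeGraph graph using (f; Joins)

  private
    link : ∀ {c : Fin m} {a b} → Link es (toℕ c) a b →
      ∃[ i ] f i ≢ c × endsOf (lookup es i) ≡ (a mod n , b mod n)
    link {c} (d , d≢c , e∈) = i , (λ eq → d≢c (trans (sym (toℕ-mod d<m)) (cong toℕ (trans d≡f eq))))
                                , cong endsOf (sym (lookup-index e∈))
      where
      i = Any.index e∈
      d<m = proj₂ (proj₂ (All.lookup bounded e∈))
      d≡f : d mod m ≡ f i
      d≡f = cong (λ e → colour e mod m) (lookup-index e∈)

    adjacent : ∀ {c : Fin m} {a b} → EqClosure (Link es (toℕ c)) a b →
      Star (λ X Y → ∃[ i ] f i ≢ c × Joins i X Y) (a mod n) (b mod n)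
    adjacent ε           = ε
    adjacent (fwd l ◅ r) = let (i , i≢c , eq) = link l in (i , i≢c , inj₁ eq) ◅ adjacent r
    adjacent (bwd l ◅ r) = let (i , i≢c , eq) = link l in (i , i≢c , inj₂ eq) ◅ adjacent r

  graph-connected : ColorConnected graph
  graph-connected A B _ c = loop-erase graph Fin._≟_
    (subst₂ (Star _) (mod-toℕ A) (mod-toℕ B) (adjacent
      (to-root A ◅◅ EqC.symmetric _ (to-root B))))
    where
    to-root : ∀ X → Connected es (toℕ c) (toℕ X) 0
    to-root X = connected (toℕ c) (toℕ X) (Fin.toℕ<n X)

-- Starting configurations and the edge count

-- The start of a cycle through 0: node 1 and colour 0 are already spent, hence k = 1.
first-edge : ∀ M → OpenEar (2 + M) 2 1 1 ((0 , 1 , 0) ∷ [])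
first-edge M = record
  { coloured = record
      { bounded = (s≤s z≤n , ≤-refl , s≤s z≤n) ∷ []
      ; simple  = [] ∷ []
      ; palette = next-colour (inj₁ (refl , λ _ ())) }
  ; 0<tip = ≤-refl
  ; tip<n = ≤-refl
  ; root-or-tip = λ where
      c 0 _ → inj₁ ε
      c 1 _ → inj₂ ε
      c (suc (suc _)) (s≤s (s≤s ()))
  ; unused = λ where
      c 0 _ _ → ε
      c 1 1≤c _ → against 0 (<⇒≢ 1≤c) (here refl)
      c (suc (suc _)) _ (s≤s (s≤s ()))
  }

-- K₄ as the union of the Hamiltonian paths 0-1-2-3 and 1-3-0-2.
K₄ : List Edge
K₄ = (0 , 1 , 0) ∷ (1 , 2 , 0) ∷ (2 , 3 , 0) ∷ (1 , 3 , 1) ∷ (0 , 3 , 1) ∷ (0 , 2 , 1) ∷ []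

K₄-colours : AllColours 2 (map colour K₄)
K₄-colours 0 _ = here refl
K₄-colours 1 _ = there (there (there (here refl)))
K₄-colours (suc (suc _)) (s≤s (s≤s ()))

K₄-network : Network 2 4 2 K₄
K₄-network = record
  { coloured = record
      { bounded = from-yes (All.all? (λ (a , b , c) → a <? b ×-dec b <? 4 ×-dec c <? 2) K₄)
      ; simple  = from-yes (AllPairs.allPairs? (λ e e′ → ¬? (≡-dec _≟_ _≟_ (pair e) (pair e′))) K₄)
      ; palette = inj₂ K₄-colours }
  ; connected = conn
  }
  where
  conn : ∀ c v → v < 4 → Connected K₄ c v 0
  conn c       0 _ = ε
  -- With colour 0 deleted the path 1-3-0-2 is followed, and 0-1-2-3 for every other c.
  conn zero    1 _ = along 1 (λ ()) (there (there (there (here refl)))) ◅◅ conn zero 3 ≤-refl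
  conn zero    2 _ = against 1 (λ ()) (there (there (there (there (there (here refl))))))
  conn zero    3 _ = against 1 (λ ()) (there (there (there (there (here refl)))))
  conn (suc c) 1 _ = against 0 (λ ()) (here refl)
  conn (suc c) 2 _ = against 0 (λ ()) (there (here refl)) ◅◅ conn (suc c) 1 (s≤s (s≤s z≤n))
  conn (suc c) 3 _ = against 0 (λ ()) (there (there (here refl))) ◅◅ conn (suc c) 2 (s≤s (s≤s (s≤s z≤n)))
  conn _ (suc (suc (suc (suc _)))) (s≤s (s≤s (s≤s (s≤s ()))))

-- The complete graph is too small for the required number of edges on one or two nodes, and for two
-- colours also on three nodes; these cases contradict the last hypothesis.
sparse-network : ∀ M n s → n ≤ suc M * s → suc n ≤ n + s → 2 * (n + s) ≤ suc n * n →
  ∃[ k ] ∃[ es ] Network (2 + M) (suc n) k es × length es ≤ n + s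
sparse-network _ zero s _ lo hi = contradiction (≤-trans lo (≤-trans (m≤m+n s _) hi)) λ ()
sparse-network _ (suc zero) s _ lo hi = contradiction (≤-trans (*-monoʳ-≤ 2 lo) hi) (<⇒≱ (from-yes (2 <? 4)))
sparse-network zero (suc (suc zero)) s room _ hi = contradiction
  (≤-trans (*-monoʳ-≤ 2 (+-monoʳ-≤ 2 (≤-trans room (≤-reflexive (*-identityˡ s))))) hi) (<⇒≱ (from-yes (6 <? 8)))
-- For m = 2 an ear has one inner node. `K₄` accounts for three non-root nodes and three units of s,
-- as 6 = 3 + 3; d nodes and t ears with d ≤ t remain.
sparse-network zero (suc (suc (suc d))) s room _ _
  with s | ≤-trans room (≤-reflexive (*-identityˡ s))
... | suc (suc (suc t)) | s≤s (s≤s (s≤s d≤t))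
  with grow d t (reopen (s≤s (s≤s z≤n)) K₄-network K₄-colours) z≤n (λ _ → refl)
         (≤-trans (≤-reflexive (+-identityʳ d)) (≤-trans d≤t (m≤m+n t 0))) refl
...   | _ , _ , net , len = _ , _ , net , ≤-trans len (≤-reflexive (arith d t))
  where
  arith : ∀ d t → 6 + d + t ≡ 3 + d + (3 + t)
  arith = solve-∀
sparse-network (suc M) (suc (suc d)) s room _ _
  with grow (suc d) s (first-edge (suc M)) (s≤s z≤n) (λ ())
         (≤-trans (≤-reflexive (+-comm (suc d) 1)) room) refl
... | _ , _ , net , len = _ , _ , net , len

graph-exists : ∀ M n s → n ≤ suc M * s → suc n ≤ n + s → 2 + M ≤ n + s → 2 * (n + s) ≤ suc n * n →
  ColorConnectedGraphExists (suc n) (n + s) (2 + M)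
graph-exists M n s room lo m≤l hi with sparse-network M n s room lo hi
... | _ , es , net , len
  with pad (n + s ∸ length es) (s≤s z≤n) net
    (*-cancelˡ-≤ 2 (≤-trans (≤-reflexive (cong (2 *_) (m+[n∸m]≡n len)))
      (≤-trans hi (≤-reflexive (sym (length-pairs (suc n)))))))
... | _ , es′ , net′ , len′ =
  graph net′ all , graph-connected net′ all , refl , l≡ , refl
  where
  l≡ : length es′ ≡ n + s
  l≡ = trans len′ (m+[n∸m]≡n len)
  all : AllColours (2 + M) (map colour es′)
  all = exhausted (Network.coloured net′) λ len≡k → ≤-trans m≤l (≤-reflexive (trans (sym l≡) len≡k))

-- Partitions

∣p∪q∣≤∣p∣+∣q∣ : ∀ {n} (p q : Subset n) → ∣ p ∪ q ∣ ≤ ∣ p ∣ + ∣ q ∣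
∣p∪q∣≤∣p∣+∣q∣ []            []            = z≤n
∣p∪q∣≤∣p∣+∣q∣ (inside  ∷ p) (inside  ∷ q) = s≤s (≤-trans (∣p∪q∣≤∣p∣+∣q∣ p q) (+-monoʳ-≤ ∣ p ∣ (n≤1+n ∣ q ∣)))
∣p∪q∣≤∣p∣+∣q∣ (inside  ∷ p) (outside ∷ q) = s≤s (∣p∪q∣≤∣p∣+∣q∣ p q)
∣p∪q∣≤∣p∣+∣q∣ (outside ∷ p) (inside  ∷ q) = ≤-trans (s≤s (∣p∪q∣≤∣p∣+∣q∣ p q)) (≤-reflexive (sym (+-suc ∣ p ∣ ∣ q ∣)))
∣p∪q∣≤∣p∣+∣q∣ (outside ∷ p) (outside ∷ q) = ∣p∪q∣≤∣p∣+∣q∣ p q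

∣⋃∣≤ : ∀ {n b} {Bs : List (Subset n)} → All (λ B → ∣ B ∣ ≤ b) Bs → ∣ ⋃ Bs ∣ ≤ length Bs * b
∣⋃∣≤ {n} [] = ≤-reflexive (∣⊥∣≡0 n)
∣⋃∣≤ {Bs = B ∷ Bs} (px ∷ pxs) = ≤-trans (∣p∪q∣≤∣p∣+∣q∣ B (⋃ Bs)) (+-mono-≤ px (∣⋃∣≤ pxs))

-- For t = 1 each single block competes in the minimum, so it has at most l - v elements; the m
-- blocks together cover all l elements.
μ-bound : ∀ {l m v} → Isμ l m 1 v → v ≤ l × l ≤ m * (l ∸ v)
μ-bound {l} {m} {v} ((𝓕 , (Bs , _ , _ , _ , v≡) , least) , _) = v≤l , (begin
  l                              ≡⟨ ∣⊤∣≡n l ⟨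
  ∣ ⊤ {l} ∣                      ≡⟨ cong ∣_∣ covers ⟨
  ∣ ⋃ blocks ∣                   ≤⟨ ∣⋃∣≤ (All.tabulate block≤) ⟩
  length blocks * (l ∸ v)        ≡⟨ cong (_* (l ∸ v)) size ⟩
  m * (l ∸ v)                    ∎)
  where
  open ≤-Reasoning
  open Partition 𝓕
  v≤l : v ≤ l
  v≤l = ≤-trans (≤-reflexive v≡) (∣p∣≤n (∁ (⋃ Bs)))
  v≤l∸ : ∀ {B} → B ∈ blocks → v ≤ l ∸ ∣ B ∣
  v≤l∸ {B} B∈ = least _ (B ∷ [] , [] ∷ [] , B∈ ∷ [] , refl ,
    sym (trans (cong (∣_∣ ∘ ∁) (∪-identityʳ B)) (∣∁p∣≡n∸∣p∣ B)))
  block≤ : ∀ {B} → B ∈ blocks → ∣ B ∣ ≤ l ∸ v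
  block≤ {B} B∈ = m+n≤o⇒m≤o∸n ∣ B ∣ (begin
    ∣ B ∣ + v             ≤⟨ +-monoʳ-≤ ∣ B ∣ (v≤l∸ B∈) ⟩
    ∣ B ∣ + (l ∸ ∣ B ∣)   ≡⟨ m+[n∸m]≡n (∣p∣≤n B) ⟩
    l                     ∎)

-- Both sets of hypotheses give enough room on the ears

theorem5p4 : (m n l : ℕ) → m ≥ 2 → n ≥ 1 → l ≥ 1 →
    m ≤ l → l ≤ (n * (n ∸ 1)) / 2 →
    ( (∃[ v ] (Isμ l m 1 v × v ≥ n ∸ 1)) →
    2 * l ≥ 2 * n →
    ColorConnectedGraphExists n l m )
    ×
    ( m > 2 →
    2 * l ≥ 2 * n →
    (∀ k → k > 0 → n ≡ (m ∸ 1) * k → l ≥ m * k ∸ 1) →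
    (∀ k → k > 0 → n ≡ (m ∸ 1) * k + 1 → l ≥ m * k) →
    (∀ j → 2 ≤ j → j ≤ m ∸ 2 →
    ∀ k → k > 0 → n ≡ (m ∸ 1) * k + j → l ≥ m * k + j) →
    ColorConnectedGraphExists n l m )
theorem5p4 (suc zero) n l (s≤s ()) _ _ _ _
theorem5p4 (suc (suc M)) (suc n) l _ _ _ m≤l hi = part-a , part-b
  where
  2l≤ : 2 * l ≤ suc n * n
  2l≤ = ≤-trans (*-monoʳ-≤ 2 hi) (≤-trans (≤-reflexive (*-comm 2 (suc n * n / 2))) (m/n*n≤m (suc n * n) 2))

  build : ∀ s → n + s ≡ l → n ≤ suc M * s → 2 * l ≥ 2 * suc n → ColorConnectedGraphExists (suc n) l (2 + M)
  build s refl room lo = graph-exists M n s room (*-cancelˡ-≤ 2 lo) m≤l 2l≤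

  part-a : ∃[ v ] (Isμ l (2 + M) 1 v × v ≥ n) → 2 * l ≥ 2 * suc n → ColorConnectedGraphExists (suc n) l (2 + M)
  -- Here n counts the nodes other than the root. One of the m copies of l - n cancels against l =
  -- (l - n) + n.
  part-a (v , μ , n≤v) = build (l ∸ n) (m+[n∸m]≡n n≤l) (+-cancelˡ-≤ (l ∸ n) _ _ (begin
    l ∸ n + n             ≡⟨ m∸n+n≡m n≤l ⟩
    l                     ≤⟨ proj₂ (μ-bound μ) ⟩
    (2 + M) * (l ∸ v)     ≤⟨ *-monoʳ-≤ (2 + M) (∸-monoʳ-≤ l n≤v) ⟩
    (2 + M) * (l ∸ n)     ∎))
    where
    open ≤-Reasoning
    n≤l = ≤-trans n≤v (proj₁ (μ-bound μ))

  part-b : 2 + M > 2 → 2 * l ≥ 2 * suc n →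
    (∀ k → k > 0 → suc n ≡ suc M * k → l ≥ (2 + M) * k ∸ 1) →
    (∀ k → k > 0 → suc n ≡ suc M * k + 1 → l ≥ (2 + M) * k) →
    (∀ j → 2 ≤ j → j ≤ M → ∀ k → k > 0 → suc n ≡ suc M * k + j → l ≥ (2 + M) * k + j) →
    ColorConnectedGraphExists (suc n) l (2 + M)
  part-b _ lo h₀ h₁ h₂ = build s n+s≡l (room (suc n / suc M) (suc n % suc M) (m%n<n (suc n) (suc M)) eq) lo
    where
    open ≤-Reasoning
    s = l ∸ n
    n<l : n < l
    n<l = *-cancelˡ-≤ 2 lo
    n+s≡l : n + s ≡ l
    n+s≡l = m+[n∸m]≡n (<⇒≤ n<l)

    eq : suc n ≡ suc M * (suc n / suc M) + suc n % suc M
    eq = trans (m≡m%n+[m/n]*n (suc n) (suc M)) (trans (+-comm (suc n % suc M) _)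
           (cong (_+ suc n % suc M) (*-comm (suc n / suc M) (suc M))))

    s≥ : ∀ {t} → t + n ≤ l → t ≤ s
    s≥ {t} = m+n≤o⇒m≤o∸n t

    -- Division of the number of nodes by m - 1, with remainder j. For j = 0 and j = 1 it is enough
    -- that s ≥ k; for j ≥ 2 one more ear is needed, so s ≥ k + 1.
    room : ∀ k j → j < suc M → suc n ≡ suc M * k + j → n ≤ suc M * s
    -- For k = 0 a single ear suffices, and s ≥ 1 because l > n.
    room zero j j<1+M e = begin
      n             ≤⟨ n≤1+n n ⟩
      suc n         ≡⟨ trans e (cong (_+ j) (*-zeroʳ M)) ⟩
      j             ≤⟨ <⇒≤ j<1+M ⟩
      suc M         ≡⟨ *-identityʳ (suc M) ⟨
      suc M * 1     ≤⟨ *-monoʳ-≤ (suc M) (s≥ n<l) ⟩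
      suc M * s     ∎
    room k@(suc _) 0 _ e = begin
      n             ≤⟨ n≤1+n n ⟩
      suc n         ≡⟨ trans e (+-identityʳ _) ⟩
      suc M * k     ≤⟨ *-monoʳ-≤ (suc M) (s≥ (begin
        k + n                 ≡⟨ cong (_∸ 1) (+-suc k n) ⟨
        k + suc n ∸ 1         ≡⟨ cong (λ h → k + h ∸ 1) (trans e (+-identityʳ _)) ⟩
        (2 + M) * k ∸ 1       ≤⟨ h₀ k (s≤s z≤n) (trans e (+-identityʳ _)) ⟩
        l                     ∎)) ⟩
      suc M * s     ∎
    room k@(suc _) 1 _ e = begin
      n             ≡⟨ n≡ ⟩
      suc M * k     ≤⟨ *-monoʳ-≤ (suc M) (s≥ (begin
        k + n                 ≡⟨ cong (k +_) n≡ ⟩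
        (2 + M) * k           ≤⟨ h₁ k (s≤s z≤n) e ⟩
        l                     ∎)) ⟩
      suc M * s     ∎
      where
      n≡ : n ≡ suc M * k
      n≡ = suc-injective (trans e (+-comm _ 1))
    room k@(suc _) j@(suc (suc _)) j<1+M e = begin
      n                     ≤⟨ n≤1+n n ⟩
      suc n                 ≡⟨ e ⟩
      suc M * k + j         ≤⟨ +-monoʳ-≤ (suc M * k) (<⇒≤ j<1+M) ⟩
      suc M * k + suc M     ≡⟨ trans (*-suc (suc M) k) (+-comm (suc M) _) ⟨
      suc M * suc k         ≤⟨ *-monoʳ-≤ (suc M) (s≥ (begin
        suc k + n             ≡⟨ +-suc k n ⟨
        k + suc n             ≡⟨ cong (k +_) e ⟩
        k + (suc M * k + j)   ≡⟨ +-assoc k _ j ⟨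
        (2 + M) * k + j       ≤⟨ h₂ j (s≤s (s≤s z≤n)) (≤-pred j<1+M) k (s≤s z≤n) e ⟩
        l                     ∎)) ⟩
      suc M * s             ∎
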